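{- Let $a_n$ be the number of inversion sequences $e\in\mathbf{I}_n$ for which there are no indices $i<j<k$ with $e_i>e_j$ and $e_j\le e_k$ (with $a_0=1$). Then $$\sum_{n\ge0}a_nz^n=\frac{1+2z-\sqrt{1-4z-4z^2}}{4z}.$$
   Context: An inversion sequence of length $n$ is an integer sequence $e=e_1\dots e_n$ with $0\le e_i<i$ for all $i$; $\mathbf{I}_n$ is the set of these, and $\mathbf{I}_0$ consists of the empty sequence. In the paper's notation $a_n=|\mathbf{I}_n(>,\leq,-)|$. -}

module Defs where

open import Data.Nat using (ℕ; zero; suc; _<_; _≤_)
import Data.Nat as ℕ
open import Data.Fin using (Fin) renaming (_<_ to _<ᶠ_)
import Data.Fin.Properties as FinP
open import Data.Vec using (Vec; []; _∷ʳ_; lookup)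
open import Data.List using (List; []; _∷_; concatMap; map; upTo; filter; length; foldr)
open import Data.Integer using (ℤ; +_; _+_; _-_; _*_; -_)
open import Data.Product using (∃; ∃-syntax; _×_; _,_)
open import Relation.Nullary using (Dec; ¬_)
open import Relation.Nullary.Decidable using (_×-dec_; ¬?)

-- I n : the list of all inversion sequences e = e₁…eₙ with 0 ≤ eᵢ < i
-- (position i, 1-indexed, is index i-1 of the vector).  Each sequence
-- appears exactly once; I 0 = [ [] ].
I : (n : ℕ) → List (Vec ℕ n)
I zero    = [] ∷ []
I (suc n) = concatMap (λ e → map (λ x → e ∷ʳ x) (upTo (suc n))) (I n)

Contains : ∀ {n} → Vec ℕ n → Set
Contains {n} e = ∃[ i ] ∃[ j ] ∃[ k ]
  ((i <ᶠ j) × (j <ᶠ k) × (lookup e j < lookup e i) × (lookup e j ≤ lookup e k))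

contains? : ∀ {n} (e : Vec ℕ n) → Dec (Contains e)
contains? e = FinP.any? λ i → FinP.any? λ j → FinP.any? λ k →
  (i FinP.<? j) ×-dec (j FinP.<? k) ×-dec
  (lookup e j ℕ.<? lookup e i) ×-dec (lookup e j ℕ.≤? lookup e k)

a : ℕ → ℕ
a n = length (filter (λ e → ¬? (contains? e)) (I n))

FPS : Set
FPS = ℕ → ℤ

_⊕_ : FPS → FPS → FPS
(f ⊕ g) n = f n + g n

_⊖_ : FPS → FPS → FPS
(f ⊖ g) n = f n - g n

_⊛_ : FPS → FPS → FPS
(f ⊛ g) n = foldr _+_ (+ 0) (map (λ i → f i * g (n ℕ.∸ i)) (upTo (suc n)))

const : ℤ → FPS
const c zero    = c
const c (suc _) = + 0

Z : FPS
Z (suc zero) = + 1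
Z _          = + 0

_·_ : ℤ → FPS → FPS
(c · f) n = c * f n

A : FPS
A n = + (a n)

infixl 6 _⊕_ _⊖_
infixl 7 _⊛_ _·_

module Submission where

-- An inversion sequence avoids the pattern iff it is weakly increasing up to its first descent
-- and strictly decreasing from the bottom of that descent on.  A left-to-right scan with states
-- "ascending, last entry M", "descending, last entry d" and "dead" recognises exactly these
-- sequences (Scan).  Counting the live completions of a partial scan (FiniteSums, Counting)
-- gives C(d, r) in a descending state, while in an ascending state the numbers K s M r
-- (current length s + M, maximum M) obey two linear recurrences (A) and (B).  Scaled by
-- 2^(s+2), the series Σᵣ K s M r zʳ form a solution of a system of equations that has at most
-- one solution (RecurrenceSystem).
-- On the algebraic side, writing the square root as S = 1 − zσ, the series σ satisfies
-- 2σ = 4(1 + z) + zσ² (SquareRoot), and then (1 + z)ᴹ (2^(s+1) + σ^(s+1)) solves the same system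
-- (AlgebraicSolution); these identities are proved with the ring solver for power series over ℤ
-- (PowerSeries).  Comparing the two solutions at s = M = 0 gives 4aₙ = [zⁿ](2 + σ), which is the
-- theorem after multiplying by z.

module PowerSeries where

  open import Data.Nat using (ℕ; zero; suc; _∸_)
  open import Data.Nat.Combinatorics using (_C_; nCk+nC[k+1]≡[n+1]C[k+1])
  import Data.Nat.Properties as ℕP
  open import Data.Integer using (ℤ; +_; _+_; _*_; -_; _^_)
  import Data.Integer as ℤ
  import Data.Integer.Properties as ℤP
  open import Data.Integer.Tactic.RingSolver using (solve-∀)
  open import Data.List using (map; foldr; upTo; applyUpTo)
  open import Data.List.Properties using (map-applyUpTo; map-upTo)
  open import Data.Maybe using (Maybe; just; nothing)
  open import Data.Product using (_,_)
  open import Function using (_∘_)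
  open import Relation.Nullary using (yes; no)
  open import Relation.Binary.PropositionalEquality
  open import Algebra.Bundles using (CommutativeRing)
  open import Algebra.Structures using (IsCommutativeRing)
  import Algebra.Construct.Pointwise as Pointwise
  open import Algebra.Solver.Ring.AlmostCommutativeRing
    using (fromCommutativeRing; _-Raw-AlmostCommutative⟶_)
  open import Defs using (FPS; _⊕_; _·_; const; Z; _⊛_)

  infix 4 _≈_
  infixl 7 _⋆_

  _≈_ : FPS → FPS → Set
  f ≈ g = ∀ n → f n ≡ g n

  tail : FPS → FPS
  tail f n = f (suc n)

  z·_ : FPS → FPS
  (z· f) zero    = + 0
  (z· f) (suc n) = f n

  _⋆_ : FPS → FPS → FPS
  (f ⋆ g) zero    = f 0 * g 0
  (f ⋆ g) (suc n) = f 0 * g (suc n) + (tail f ⋆ g) n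

  neg : FPS → FPS
  neg f n = - f n

  zeroˢ : FPS
  zeroˢ _ = + 0

  ⋆-congˡ : ∀ {f f′} g → f ≈ f′ → f ⋆ g ≈ f′ ⋆ g
  ⋆-congˡ g f≈f′ zero    = cong (_* g 0) (f≈f′ 0)
  ⋆-congˡ g f≈f′ (suc n) =
    cong₂ _+_ (cong (_* g (suc n)) (f≈f′ 0)) (⋆-congˡ g (f≈f′ ∘ suc) n)

  ⋆-congʳ : ∀ f {g g′} → g ≈ g′ → f ⋆ g ≈ f ⋆ g′
  ⋆-congʳ f g≈g′ zero    = cong (f 0 *_) (g≈g′ 0)
  ⋆-congʳ f g≈g′ (suc n) = cong₂ _+_ (cong (f 0 *_) (g≈g′ (suc n))) (⋆-congʳ (tail f) g≈g′ n)

  ⋆-zeroˡ : ∀ g → zeroˢ ⋆ g ≈ zeroˢ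
  ⋆-zeroˡ g zero    = refl
  ⋆-zeroˡ g (suc n) = trans (ℤP.+-identityˡ _) (⋆-zeroˡ g n)

  const-⋆ : ∀ c f → const c ⋆ f ≈ c · f
  const-⋆ c f zero    = refl
  const-⋆ c f (suc n) = trans (cong (λ x → c * f (suc n) + x) (⋆-zeroˡ f n)) (ℤP.+-identityʳ _)

  ⋆-identityˡ : ∀ f → const (+ 1) ⋆ f ≈ f
  ⋆-identityˡ f n = trans (const-⋆ (+ 1) f n) (ℤP.*-identityˡ (f n))

  ⋆-scaleˡ : ∀ c f g → (c · f) ⋆ g ≈ c · (f ⋆ g)
  ⋆-scaleˡ c f g zero    = ℤP.*-assoc c (f 0) (g 0)
  ⋆-scaleˡ c f g (suc n) =
    trans (cong₂ _+_ (ℤP.*-assoc c (f 0) (g (suc n))) (⋆-scaleˡ c (tail f) g n))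
          (sym (ℤP.*-distribˡ-+ c (f 0 * g (suc n)) ((tail f ⋆ g) n)))

  private
    interchange : ∀ a b c d → (a + b) + (c + d) ≡ (a + c) + (b + d)
    interchange = solve-∀

    reassociate : ∀ a b c d e → (a * b) * c + (a * d + e) ≡ a * (b * c + d) + e
    reassociate = solve-∀

  ⋆-distribʳ : ∀ h f g → (f ⊕ g) ⋆ h ≈ f ⋆ h ⊕ g ⋆ h
  ⋆-distribʳ h f g zero    = ℤP.*-distribʳ-+ (h 0) (f 0) (g 0)
  ⋆-distribʳ h f g (suc n) =
    trans (cong₂ _+_ (ℤP.*-distribʳ-+ (h (suc n)) (f 0) (g 0)) (⋆-distribʳ h (tail f) (tail g) n))
          (interchange (f 0 * h (suc n)) (g 0 * h (suc n)) ((tail f ⋆ h) n) ((tail g ⋆ h) n))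

  ⋆-distribˡ : ∀ h f g → h ⋆ (f ⊕ g) ≈ h ⋆ f ⊕ h ⋆ g
  ⋆-distribˡ h f g zero    = ℤP.*-distribˡ-+ (h 0) (f 0) (g 0)
  ⋆-distribˡ h f g (suc n) =
    trans (cong₂ _+_ (ℤP.*-distribˡ-+ (h 0) (f (suc n)) (g (suc n))) (⋆-distribˡ (tail h) f g n))
          (interchange (h 0 * f (suc n)) (h 0 * g (suc n)) ((tail h ⋆ f) n) ((tail h ⋆ g) n))

  -- The last term of the Cauchy sum can be split off instead of the first:
  -- (f g)ₙ₊₁ = (f · tail g)ₙ + fₙ₊₁ g₀.  Together with the recursion this gives commutativity.
  ⋆-unfoldʳ : ∀ f g n → (f ⋆ g) (suc n) ≡ (f ⋆ tail g) n + f (suc n) * g 0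
  ⋆-unfoldʳ f g zero    = refl
  ⋆-unfoldʳ f g (suc n) =
    trans (cong (λ x → f 0 * g (suc (suc n)) + x) (⋆-unfoldʳ (tail f) g n))
          (sym (ℤP.+-assoc (f 0 * g (suc (suc n))) ((tail f ⋆ tail g) n) (f (suc (suc n)) * g 0)))

  ⋆-comm : ∀ f g → f ⋆ g ≈ g ⋆ f
  ⋆-comm f g zero    = ℤP.*-comm (f 0) (g 0)
  ⋆-comm f g (suc n) =
    trans (cong₂ _+_ (ℤP.*-comm (f 0) (g (suc n))) (⋆-comm (tail f) g n))
          (trans (ℤP.+-comm (g (suc n) * f 0) ((g ⋆ tail f) n)) (sym (⋆-unfoldʳ g f n)))

  ⋆-assoc : ∀ f g h → (f ⋆ g) ⋆ h ≈ f ⋆ (g ⋆ h)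
  ⋆-assoc f g h zero    = ℤP.*-assoc (f 0) (g 0) (h 0)
  ⋆-assoc f g h (suc n) = begin
    (f 0 * g 0) * h (suc n) + (tail (f ⋆ g) ⋆ h) n
      ≡⟨ cong (λ x → (f 0 * g 0) * h (suc n) + x) (⋆-distribʳ h (f 0 · tail g) (tail f ⋆ g) n) ⟩
    (f 0 * g 0) * h (suc n) + (((f 0 · tail g) ⋆ h) n + ((tail f ⋆ g) ⋆ h) n)
      ≡⟨ cong₂ (λ x y → (f 0 * g 0) * h (suc n) + (x + y)) (⋆-scaleˡ (f 0) (tail g) h n) (⋆-assoc (tail f) g h n) ⟩
    (f 0 * g 0) * h (suc n) + (f 0 * (tail g ⋆ h) n + (tail f ⋆ (g ⋆ h)) n)
      ≡⟨ reassociate (f 0) (g 0) (h (suc n)) ((tail g ⋆ h) n) ((tail f ⋆ (g ⋆ h)) n) ⟩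
    f 0 * (g 0 * h (suc n) + (tail g ⋆ h) n) + (tail f ⋆ (g ⋆ h)) n
      ∎
    where open ≡-Reasoning

  isCommutativeRing : IsCommutativeRing _≈_ _⊕_ _⋆_ neg zeroˢ (const (+ 1))
  isCommutativeRing = record
    { isRing = record
      { +-isAbelianGroup = Pointwise.isAbelianGroup ℕ ℤP.+-0-isAbelianGroup
      ; *-cong     = λ {f} {f′} {g} f≈f′ g≈g′ n → trans (⋆-congˡ g f≈f′ n) (⋆-congʳ f′ g≈g′ n)
      ; *-assoc    = ⋆-assoc
      ; *-identity = ⋆-identityˡ , λ f n → trans (⋆-comm f (const (+ 1)) n) (⋆-identityˡ f n)
      ; distrib    = ⋆-distribˡ , ⋆-distribʳ
      }
    ; *-comm = ⋆-comm
    }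

  ring : CommutativeRing _ _
  ring = record { isCommutativeRing = isCommutativeRing }

  const-* : ∀ a b → const (a * b) ≈ const a ⋆ const b
  const-* a b zero    = refl
  const-* a b (suc n) = sym (trans (const-⋆ a (const b) (suc n)) (ℤP.*-zeroʳ a))

  module Solver where

    constMorphism : ℤ.+-*-rawRing -Raw-AlmostCommutative⟶ fromCommutativeRing ring
    constMorphism = record
      { ⟦_⟧    = const
      ; +-homo = λ { a b zero → refl ; a b (suc n) → refl }
      ; *-homo = const-*
      ; -‿homo = λ { a zero → refl ; a (suc n) → refl }
      ; 0-homo = λ { zero → refl ; (suc n) → refl }
      ; 1-homo = λ n → refl
      }

    const-≟ : ∀ a b → Maybe (const a ≈ const b)
    const-≟ a b with a ℤ.≟ b
    ... | yes refl = just (λ n → refl)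
    ... | no _     = nothing

    open import Algebra.Solver.Ring ℤ.+-*-rawRing (fromCommutativeRing ring) constMorphism const-≟ public

  -- The Cauchy product  Σᵢ fᵢ gₙ₋ᵢ  of the problem statement agrees with _⋆_: dropping the
  -- i = 0 term and reindexing i ↦ i + 1 leaves the same sum for tail f.
  ⊛≈⋆ : ∀ f g → f ⊛ g ≈ f ⋆ g
  ⊛≈⋆ f g zero    = ℤP.+-identityʳ (f 0 * g 0)
  ⊛≈⋆ f g (suc n) = cong (λ x → f 0 * g (suc n) + x) (begin
    foldr _+_ (+ 0) (map term (applyUpTo suc (suc n)))  ≡⟨ cong (foldr _+_ (+ 0)) reindex ⟩
    (tail f ⊛ g) n                                     ≡⟨ ⊛≈⋆ (tail f) g n ⟩
    (tail f ⋆ g) n                                     ∎)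
    where
    open ≡-Reasoning
    term : ℕ → ℤ
    term i = f i * g (suc n ∸ i)
    reindex : map term (applyUpTo suc (suc n)) ≡ map (term ∘ suc) (upTo (suc n))
    reindex = trans (map-applyUpTo suc term (suc n)) (sym (map-upTo (term ∘ suc) (suc n)))

  Z⋆≈z· : ∀ f → Z ⋆ f ≈ z· f
  Z⋆≈z· f zero    = refl
  Z⋆≈z· f (suc n) = trans (ℤP.+-identityˡ _) (trans (⋆-congˡ f tail-Z n) (⋆-identityˡ f n))
    where
    tail-Z : tail Z ≈ const (+ 1)
    tail-Z zero    = refl
    tail-Z (suc k) = refl

  1+z : FPS
  1+z = const (+ 1) ⊕ Z

  binomial : ℕ → FPS
  binomial M n = + (M C n)

  infixr 8 _^ˢ_

  _^ˢ_ : FPS → ℕ → FPS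
  f ^ˢ zero  = const (+ 1)
  f ^ˢ suc k = f ⋆ f ^ˢ k

  z·-cong : ∀ {f g} → f ≈ g → z· f ≈ z· g
  z·-cong f≈g zero    = refl
  z·-cong f≈g (suc n) = f≈g n

  const-^ : ∀ c k → const c ^ˢ k ≈ const (c ^ k)
  const-^ c zero    = λ n → refl
  const-^ c (suc k) n = trans (⋆-congʳ (const c) (const-^ c k) n) (sym (const-* c (c ^ k) n))

  binomial-theorem : ∀ M → 1+z ^ˢ M ≈ binomial M
  binomial-theorem zero    zero    = refl
  binomial-theorem zero    (suc n) = refl
  binomial-theorem (suc M) n = begin
    (1+z ⋆ v) n
      ≡⟨ ⋆-distribʳ v (const (+ 1)) Z n ⟩
    (const (+ 1) ⋆ v) n + (Z ⋆ v) n
      ≡⟨ cong₂ _+_ (⋆-identityˡ v n) (Z⋆≈z· v n) ⟩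
    v n + (z· v) n
      ≡⟨ cong₂ _+_ (binomial-theorem M n) (z·-cong (binomial-theorem M) n) ⟩
    binomial M n + (z· binomial M) n
      ≡⟨ pascal n ⟩
    binomial (suc M) n ∎
    where
    open ≡-Reasoning
    v : FPS
    v = 1+z ^ˢ M
    pascal : ∀ n → binomial M n + (z· binomial M) n ≡ binomial (suc M) n
    pascal zero    = refl
    pascal (suc n) = trans (sym (ℤP.pos-+ (M C suc n) (M C n)))
                           (cong +_ (trans (ℕP.+-comm (M C suc n) (M C n)) (nCk+nC[k+1]≡[n+1]C[k+1] M n)))

  const-⋆-coeff : ∀ c {f g} → f ≈ g → ∀ n → (const c ⋆ f) n ≡ c * g n
  const-⋆-coeff c {f} f≈g n = trans (const-⋆ c f n) (cong (c *_) (f≈g n))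


module Scan where

  open import Data.Nat using (ℕ; zero; suc; _<_; _≤_; _<?_; s≤s⁻¹)
  open import Data.Nat.Properties using (≤-refl; ≤-trans; <⇒≤; <-trans; <-≤-trans; <-irrefl; ≮⇒≥; ≤⇒≯; n≮0)
  open import Data.Fin using (Fin; zero; suc; toℕ; inject₁; fromℕ) renaming (_<_ to _<ᶠ_)
  import Data.Fin.Properties as FinP
  open import Data.Vec using (Vec; []; _∷_; _∷ʳ_; lookup; foldl)
  open import Data.Vec.Properties using (foldl-∷ʳ)
  open import Data.Bool using (if_then_else_)
  open import Data.Product using (∃; ∃₂; _×_; _,_)
  open import Data.Sum using (_⊎_; inj₁; inj₂)
  open import Data.Empty using (⊥-elim)
  open import Relation.Nullary using (¬_; yes; no; does)
  open import Relation.Nullary.Decidable using (dec-true; dec-false)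
  open import Relation.Binary.PropositionalEquality
  open import Defs using (Contains)

  data Position : ∀ {n} → Fin (suc n) → Set where
    old : ∀ {n} (i : Fin n) → Position (inject₁ i)
    new : ∀ {n} → Position (fromℕ n)

  position : ∀ {n} (i : Fin (suc n)) → Position i
  position {zero}  zero    = new
  position {suc n} zero    = old zero
  position {suc n} (suc i) with position i
  ... | old j = old (suc j)
  ... | new   = new

  lookup-old : ∀ {n} (e : Vec ℕ n) x i → lookup (e ∷ʳ x) (inject₁ i) ≡ lookup e i
  lookup-old (y ∷ e) x zero    = refl
  lookup-old (y ∷ e) x (suc i) = lookup-old e x i

  lookup-new : ∀ {n} (e : Vec ℕ n) x → lookup (e ∷ʳ x) (fromℕ n) ≡ x
  lookup-new []      x = refl
  lookup-new (y ∷ e) x = lookup-new e x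

  old<new : ∀ {n} (i : Fin n) → inject₁ i <ᶠ fromℕ n
  old<new {n} i = subst₂ _<_ (sym (FinP.toℕ-inject₁ i)) (sym (FinP.toℕ-fromℕ n)) (FinP.toℕ<n i)

  new≮ : ∀ {n} (j : Fin (suc n)) → ¬ (fromℕ n <ᶠ j)
  new≮ {n} j new<j =
    <-irrefl refl (<-≤-trans (subst (_< toℕ j) (FinP.toℕ-fromℕ n) new<j) (s≤s⁻¹ (FinP.toℕ<n j)))

  inject₁-cancel-< : ∀ {n} {i j : Fin n} → inject₁ i <ᶠ inject₁ j → i <ᶠ j
  inject₁-cancel-< {i = i} {j} = subst₂ _<_ (FinP.toℕ-inject₁ i) (FinP.toℕ-inject₁ j)

  inject₁-mono-< : ∀ {n} {i j : Fin n} → i <ᶠ j → inject₁ i <ᶠ inject₁ j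
  inject₁-mono-< {i = i} {j} = subst₂ _<_ (sym (FinP.toℕ-inject₁ i)) (sym (FinP.toℕ-inject₁ j))

  Descent : ∀ {n} → Vec ℕ n → Fin n → Fin n → Set
  Descent e i j = (i <ᶠ j) × (lookup e j < lookup e i)

  Ascending : ∀ {n} → Vec ℕ n → Set
  Ascending e = ∀ i j → i <ᶠ j → lookup e i ≤ lookup e j

  ascending⇒no-descent : ∀ {n} (e : Vec ℕ n) → Ascending e → ∀ {i j} → ¬ Descent e i j
  ascending⇒no-descent e asc {i} {j} (i<j , ej<ei) = <-irrefl refl (<-≤-trans ej<ei (asc i j i<j))

  BottomsAtLeast : ∀ {n} → Vec ℕ n → ℕ → Set
  BottomsAtLeast e y = ∀ i j → Descent e i j → y ≤ lookup e j

  descent-old : ∀ {n} (e : Vec ℕ n) {x i j} → Descent e i j →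
                Descent (e ∷ʳ x) (inject₁ i) (inject₁ j)
  descent-old e {x} {i} {j} (i<j , ej<ei) =
    inject₁-mono-< i<j , subst₂ _<_ (sym (lookup-old e x j)) (sym (lookup-old e x i)) ej<ei

  descent-new : ∀ {n} (e : Vec ℕ n) {x i} → x < lookup e i →
                Descent (e ∷ʳ x) (inject₁ i) (fromℕ n)
  descent-new e {x} {i} x<ei =
    old<new i , subst₂ _<_ (sym (lookup-new e x)) (sym (lookup-old e x i)) x<ei

  bottoms-snoc : ∀ {n} (e : Vec ℕ n) {x} → BottomsAtLeast e x → BottomsAtLeast (e ∷ʳ x) x
  bottoms-snoc e {x} bounded i j (i<j , d) with position i | position j
  ... | _      | new    rewrite lookup-new e x = ≤-refl
  ... | new    | old j′ = ⊥-elim (new≮ _ i<j)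
  ... | old i′ | old j′ rewrite lookup-old e x i′ | lookup-old e x j′ =
    bounded i′ j′ (inject₁-cancel-< i<j , d)

  contains-snoc-elim : ∀ {n} (e : Vec ℕ n) x → Contains (e ∷ʳ x) →
                       Contains e ⊎ ∃₂ λ i j → Descent e i j × lookup e j ≤ x
  contains-snoc-elim e x (i , j , k , i<j , j<k , d , le) with position i | position j | position k
  ... | _      | new    | _      = ⊥-elim (new≮ _ j<k)
  ... | new    | old _  | _      = ⊥-elim (new≮ _ i<j)
  ... | old i′ | old j′ | new rewrite lookup-old e x i′ | lookup-old e x j′ | lookup-new e x =
    inj₂ (i′ , j′ , (inject₁-cancel-< i<j , d) , le)
  ... | old i′ | old j′ | old k′ rewrite lookup-old e x i′ | lookup-old e x j′ | lookup-old e x k′ =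
    inj₁ (i′ , j′ , k′ , inject₁-cancel-< i<j , inject₁-cancel-< j<k , d , le)

  contains-snoc-old : ∀ {n} (e : Vec ℕ n) x → Contains e → Contains (e ∷ʳ x)
  contains-snoc-old e x (i , j , k , i<j , j<k , d , le) =
    inject₁ i , inject₁ j , inject₁ k , inject₁-mono-< i<j , inject₁-mono-< j<k ,
    subst₂ _<_ (sym (lookup-old e x j)) (sym (lookup-old e x i)) d ,
    subst₂ _≤_ (sym (lookup-old e x j)) (sym (lookup-old e x k)) le

  contains-snoc-new : ∀ {n} (e : Vec ℕ n) x {i j} → Descent e i j → lookup e j ≤ x → Contains (e ∷ʳ x)
  contains-snoc-new {n} e x {i} {j} desc ej≤x with descent-old e {x} desc
  ... | i<j , d = inject₁ i , inject₁ j , fromℕ n , i<j , old<new j , d ,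
                  subst₂ _≤_ (sym (lookup-old e x j)) (sym (lookup-new e x)) ej≤x

  avoid-snoc : ∀ {n} (e : Vec ℕ n) {x} → ¬ Contains e → (∀ i j → Descent e i j → x < lookup e j) →
               ¬ Contains (e ∷ʳ x)
  avoid-snoc e {x} avoids above c with contains-snoc-elim e x c
  ... | inj₁ c′ = avoids c′
  ... | inj₂ (i , j , desc , ej≤x) = <-irrefl refl (<-≤-trans (above i j desc) ej≤x)

  -- The states of a left-to-right scan.  An avoiding sequence is weakly increasing up to its
  -- first descent; after it every entry must be strictly below the previous one.
  data State : Set where
    ascending  : ℕ → State   -- no descent yet; the argument is the last (= largest) entry
    descending : ℕ → State   -- a descent occurred; the argument is the last entry
    dead       : State

  step : State → ℕ → State
  step (ascending M)  x = if does (x <? M) then descending x else ascending x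
  step (descending d) x = if does (x <? d) then descending x else dead
  step dead           _ = dead

  run : ∀ {n} → Vec ℕ n → State
  run = foldl (λ _ → State) step (ascending 0)

  run-snoc : ∀ {n} (e : Vec ℕ n) x → run (e ∷ʳ x) ≡ step (run e) x
  run-snoc e x = foldl-∷ʳ (λ _ → State) step (ascending 0) x e

  Invariant : ∀ {n} → Vec ℕ n → State → Set
  Invariant e (ascending M)  = ¬ Contains e × Ascending e × (∀ i → lookup e i ≤ M)
                             × (∀ x → x < M → ∃ λ i → x < lookup e i)
  Invariant e (descending d) = ¬ Contains e × BottomsAtLeast e d
                             × ∃₂ λ i j → Descent e i j × lookup e j ≡ d
  Invariant e dead           = Contains e

  -- The four transitions out of a live state preserve the invariant: appending x below the
  -- last entry starts or continues the decreasing part; appending x ≥ M extends the increasing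
  -- part; appending x ≥ d after a descent with bottom d completes the pattern.
  ascending-down : ∀ {n} (e : Vec ℕ n) {M x} → Invariant e (ascending M) → x < M →
                   Invariant (e ∷ʳ x) (descending x)
  ascending-down e {x = x} (avoids , asc , _ , below) x<M =
    avoid-snoc e avoids no-descent ,
    bottoms-snoc e (λ i j desc → <⇒≤ (no-descent i j desc)) ,
    (let i , x<ei = below x x<M in inject₁ i , _ , descent-new e x<ei , lookup-new e x)
    where
    no-descent : ∀ i j → Descent e i j → x < lookup e j
    no-descent i j desc = ⊥-elim (ascending⇒no-descent e asc desc)

  ascending-up : ∀ {n} (e : Vec ℕ n) {M x} → Invariant e (ascending M) → M ≤ x →
                 Invariant (e ∷ʳ x) (ascending x)
  ascending-up {n} e {x = x} (avoids , asc , bounded , _) M≤x =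
    avoid-snoc e avoids (λ i j desc → ⊥-elim (ascending⇒no-descent e asc desc)) ,
    asc′ , bounded′ , λ y y<x → fromℕ n , subst (y <_) (sym (lookup-new e x)) y<x
    where
    bounded′ : ∀ i → lookup (e ∷ʳ x) i ≤ x
    bounded′ i with position i
    ... | new    rewrite lookup-new e x = ≤-refl
    ... | old i′ rewrite lookup-old e x i′ = ≤-trans (bounded i′) M≤x
    asc′ : Ascending (e ∷ʳ x)
    asc′ i j i<j with position i | position j
    ... | new    | _      = ⊥-elim (new≮ _ i<j)
    ... | old i′ | new    rewrite lookup-old e x i′ | lookup-new e x = ≤-trans (bounded i′) M≤x
    ... | old i′ | old j′ rewrite lookup-old e x i′ | lookup-old e x j′ = asc i′ j′ (inject₁-cancel-< i<j)

  descending-down : ∀ {n} (e : Vec ℕ n) {d x} → Invariant e (descending d) → x < d →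
                    Invariant (e ∷ʳ x) (descending x)
  descending-down e {d} {x} (avoids , bottoms , i , _ , (_ , ej<ei) , ej≡d) x<d =
    avoid-snoc e avoids (λ i j desc → <-≤-trans x<d (bottoms i j desc)) ,
    bottoms-snoc e (λ i j desc → <⇒≤ (<-≤-trans x<d (bottoms i j desc))) ,
    inject₁ i , _ , descent-new e (<-trans (subst (x <_) (sym ej≡d) x<d) ej<ei) , lookup-new e x

  descending-up : ∀ {n} (e : Vec ℕ n) {d x} → Invariant e (descending d) → d ≤ x → Contains (e ∷ʳ x)
  descending-up e {x = x} (_ , _ , _ , _ , desc , ej≡d) d≤x =
    contains-snoc-new e x desc (subst (_≤ x) (sym ej≡d) d≤x)

  step-ascending-< : ∀ {M x} → x < M → step (ascending M) x ≡ descending x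
  step-ascending-< {M} {x} x<M = cong (if_then descending x else ascending x) (dec-true (x <? M) x<M)

  step-ascending-≥ : ∀ {M x} → M ≤ x → step (ascending M) x ≡ ascending x
  step-ascending-≥ {M} {x} M≤x = cong (if_then descending x else ascending x) (dec-false (x <? M) (≤⇒≯ M≤x))

  step-descending-< : ∀ {d x} → x < d → step (descending d) x ≡ descending x
  step-descending-< {d} {x} x<d = cong (if_then descending x else dead) (dec-true (x <? d) x<d)

  step-descending-≥ : ∀ {d x} → d ≤ x → step (descending d) x ≡ dead
  step-descending-≥ {d} {x} d≤x = cong (if_then descending x else dead) (dec-false (x <? d) (≤⇒≯ d≤x))

  invariant-step : ∀ {n} (e : Vec ℕ n) x σ → Invariant e σ → Invariant (e ∷ʳ x) (step σ x)
  invariant-step e x (ascending M) inv with x <? M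
  ... | yes x<M = subst (Invariant _) (sym (step-ascending-< x<M)) (ascending-down e inv x<M)
  ... | no  x≮M = subst (Invariant _) (sym (step-ascending-≥ (≮⇒≥ x≮M))) (ascending-up e inv (≮⇒≥ x≮M))
  invariant-step e x (descending d) inv with x <? d
  ... | yes x<d = subst (Invariant _) (sym (step-descending-< x<d)) (descending-down e inv x<d)
  ... | no  x≮d = subst (Invariant _) (sym (step-descending-≥ (≮⇒≥ x≮d))) (descending-up e inv (≮⇒≥ x≮d))
  invariant-step e x dead c = contains-snoc-old e x c

  snoc-induction : (P : ∀ {n} → Vec ℕ n → Set) → P [] →
                   (∀ {n} (e : Vec ℕ n) x → P e → P (e ∷ʳ x)) → ∀ {n} (e : Vec ℕ n) → P e
  snoc-induction P base snoc []      = base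
  snoc-induction P base snoc (y ∷ e) =
    snoc-induction (λ e′ → P (y ∷ e′)) (snoc [] y base) (λ e′ → snoc (y ∷ e′)) e

  invariant-run : ∀ {n} (e : Vec ℕ n) → Invariant e (run e)
  invariant-run = snoc-induction (λ e → Invariant e (run e)) initial
    (λ e x inv → subst (Invariant (e ∷ʳ x)) (sym (run-snoc e x)) (invariant-step e x (run e) inv))
    where
    initial : Invariant [] (ascending 0)
    initial = (λ { (() , _) }) , (λ ()) , (λ ()) , λ x x<0 → ⊥-elim (n≮0 x<0)

  live : State → ℕ
  live (ascending _)  = 1
  live (descending _) = 1
  live dead           = 0

  live-run : ∀ {n} (e : Vec ℕ n) → (Contains e → live (run e) ≡ 0) × (¬ Contains e → live (run e) ≡ 1)
  live-run e with run e | invariant-run e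
  ... | ascending _  | avoids , _ = (λ c → ⊥-elim (avoids c)) , λ _ → refl
  ... | descending _ | avoids , _ = (λ c → ⊥-elim (avoids c)) , λ _ → refl
  ... | dead         | c          = (λ _ → refl) , λ avoids → ⊥-elim (avoids c)


module FiniteSums where

  open import Data.Nat using (ℕ; zero; suc; _+_; _<_; _≤_; _≤′_; ≤′-refl; ≤′-step; s≤s⁻¹)
  open import Data.Nat.Properties
  open import Algebra.Properties.CommutativeSemigroup +-commutativeSemigroup using (xy∙z≈xz∙y)
  open import Data.Nat.Combinatorics using (_C_; nCk+nC[k+1]≡[n+1]C[k+1])
  open import Data.Nat.ListAction using (sum)
  open import Data.Nat.ListAction.Properties using (sum-++)
  open import Data.List using (List; []; _∷_; [_]; _++_; _∷ʳ_; map; upTo; concatMap)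
  open import Data.List.Properties using (map-++; upTo-∷ʳ)
  open import Function using (_∘_)
  open import Relation.Nullary using (yes; no)
  open import Relation.Binary.PropositionalEquality
    using (_≡_; _≢_; refl; sym; trans; cong; cong₂; module ≡-Reasoning)

  Σ< : (ℕ → ℕ) → ℕ → ℕ
  Σ< f zero    = 0
  Σ< f (suc k) = Σ< f k + f k

  sum-upTo : ∀ f k → sum (map f (upTo k)) ≡ Σ< f k
  sum-upTo f zero    = refl
  sum-upTo f (suc k) = begin
    sum (map f (upTo (suc k)))        ≡⟨ cong (sum ∘ map f) (upTo-∷ʳ k) ⟨
    sum (map f (upTo k ∷ʳ k))         ≡⟨ cong sum (map-++ f (upTo k) [ k ]) ⟩
    sum (map f (upTo k) ++ [ f k ])   ≡⟨ sum-++ (map f (upTo k)) [ f k ] ⟩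
    sum (map f (upTo k)) + (f k + 0)  ≡⟨ cong₂ _+_ (sum-upTo f k) (+-identityʳ (f k)) ⟩
    Σ< f k + f k                      ∎
    where open ≡-Reasoning

  sum-concatMap : ∀ {A B : Set} (f : B → ℕ) (g : A → List B) xs →
                  sum (map f (concatMap g xs)) ≡ sum (map (sum ∘ map f ∘ g) xs)
  sum-concatMap f g []       = refl
  sum-concatMap f g (x ∷ xs) = begin
    sum (map f (g x ++ concatMap g xs))             ≡⟨ cong sum (map-++ f (g x) (concatMap g xs)) ⟩
    sum (map f (g x) ++ map f (concatMap g xs))     ≡⟨ sum-++ (map f (g x)) _ ⟩
    sum (map f (g x)) + sum (map f (concatMap g xs)) ≡⟨ cong (sum (map f (g x)) +_) (sum-concatMap f g xs) ⟩
    sum (map (sum ∘ map f ∘ g) (x ∷ xs))            ∎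
    where open ≡-Reasoning

  Σ<-cong : ∀ f g k → (∀ x → x < k → f x ≡ g x) → Σ< f k ≡ Σ< g k
  Σ<-cong f g zero    agree = refl
  Σ<-cong f g (suc k) agree = cong₂ _+_ (Σ<-cong f g k (λ x x<k → agree x (m<n⇒m<1+n x<k))) (agree k ≤-refl)

  Σ<-vanishing : ∀ f {d k} → d ≤ k → (∀ x → d ≤ x → f x ≡ 0) → Σ< f k ≡ Σ< f d
  Σ<-vanishing f {d} d≤k vanish = go (≤⇒≤′ d≤k)
    where
    go : ∀ {k} → d ≤′ k → Σ< f k ≡ Σ< f d
    go ≤′-refl       = refl
    go (≤′-step d≤k) = trans (cong₂ _+_ (go d≤k) (vanish _ (≤′⇒≤ d≤k))) (+-identityʳ _)

  Σ<-exchange : ∀ f g {p} k → p < k → (∀ x → x ≢ p → f x ≡ g x) → Σ< f k + g p ≡ Σ< g k + f p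
  Σ<-exchange f g {p} (suc k) p<k agree with p ≟ k
  ... | yes refl = begin
    Σ< f p + f p + g p  ≡⟨ cong (λ s → s + f p + g p) (Σ<-cong f g p (λ x x<p → agree x (<⇒≢ x<p))) ⟩
    Σ< g p + f p + g p  ≡⟨ xy∙z≈xz∙y (Σ< g p) (f p) (g p) ⟩
    Σ< g p + g p + f p  ∎
    where open ≡-Reasoning
  ... | no p≢k = begin
    Σ< f k + f k + g p  ≡⟨ xy∙z≈xz∙y (Σ< f k) (f k) (g p) ⟩
    Σ< f k + g p + f k  ≡⟨ cong₂ _+_ (Σ<-exchange f g k (≤∧≢⇒< (s≤s⁻¹ p<k) p≢k) agree) (agree k (p≢k ∘ sym)) ⟩
    Σ< g k + f p + g k  ≡⟨ xy∙z≈xz∙y (Σ< g k) (f p) (g k) ⟩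
    Σ< g k + g k + f p  ∎
    where open ≡-Reasoning

  hockey-stick : ∀ r d → Σ< (_C r) d ≡ d C suc r
  hockey-stick r zero    = refl
  hockey-stick r (suc d) = begin
    Σ< (_C r) d + d C r   ≡⟨ cong (_+ d C r) (hockey-stick r d) ⟩
    d C suc r + d C r     ≡⟨ +-comm (d C suc r) (d C r) ⟩
    d C r + d C suc r     ≡⟨ nCk+nC[k+1]≡[n+1]C[k+1] d r ⟩
    suc d C suc r         ∎
    where open ≡-Reasoning


module Counting where

  open import Data.Nat using (ℕ; zero; suc; _+_; _<_; _≤_; z≤n; s≤s)
  open import Data.Nat.Properties
  open import Data.Nat.Combinatorics using (_C_)
  open import Data.Nat.ListAction using (sum)
  open import Data.List using (List; []; _∷_; map; upTo; filter; length)
  open import Data.List.Properties using (map-∘; map-cong)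
  open import Data.Vec using (Vec)
  import Data.Vec as Vec
  open import Data.Product using (proj₁; proj₂)
  open import Data.Empty using (⊥-elim)
  open import Function using (_∘_)
  open import Relation.Nullary using (yes; no)
  open import Relation.Nullary.Decidable using (¬?)
  open import Relation.Binary.Definitions using (tri<; tri≈; tri>)
  open import Relation.Binary.PropositionalEquality
    using (_≡_; _≢_; refl; sym; trans; cong; cong₂; module ≡-Reasoning)
  open import Defs using (I; a; contains?)
  open FiniteSums
  open Scan

  a≡live-count : ∀ n → a n ≡ sum (map (live ∘ run) (I n))
  a≡live-count n = go (I n)
    where
    go : ∀ {m} (es : List (Vec ℕ m)) → length (filter (¬? ∘ contains?) es) ≡ sum (map (live ∘ run) es)
    go []       = refl
    go (e ∷ es) with contains? e
    ... | yes c      = trans (go es) (cong (_+ sum (map (live ∘ run) es)) (sym (proj₁ (live-run e) c)))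
    ... | no avoids  = trans (cong suc (go es)) (cong (_+ sum (map (live ∘ run) es)) (sym (proj₂ (live-run e) avoids)))

  -- completions m r σ: the number of ways to extend a sequence of length m, whose scan is in
  -- state σ, by r further entries (the next one ranging over 0, …, m, and so on) such that the
  -- scan ends alive.
  completions : ℕ → ℕ → State → ℕ
  completions m zero    σ = live σ
  completions m (suc r) σ = Σ< (λ x → completions (suc m) r (step σ x)) (suc m)

  sum-I-suc : ∀ m (φ : State → ℕ) →
              sum (map (φ ∘ run) (I (suc m))) ≡ sum (map (λ e → Σ< (λ x → φ (step (run e) x)) (suc m)) (I m))
  sum-I-suc m φ = trans (sum-concatMap (φ ∘ run) extensions (I m)) (cong sum (map-cong extend (I m)))
    where
    extensions : Vec ℕ m → List (Vec ℕ (suc m))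
    extensions e = map (e Vec.∷ʳ_) (upTo (suc m))
    extend : ∀ e → sum (map (φ ∘ run) (extensions e)) ≡ Σ< (λ x → φ (step (run e) x)) (suc m)
    extend e = begin
      sum (map (φ ∘ run) (map (e Vec.∷ʳ_) (upTo (suc m))))  ≡⟨ cong sum (map-∘ (upTo (suc m))) ⟨
      sum (map (φ ∘ run ∘ (e Vec.∷ʳ_)) (upTo (suc m)))      ≡⟨ cong sum (map-cong (cong φ ∘ run-snoc e) (upTo (suc m))) ⟩
      sum (map (λ x → φ (step (run e) x)) (upTo (suc m)))    ≡⟨ sum-upTo _ (suc m) ⟩
      Σ< (λ x → φ (step (run e) x)) (suc m)                  ∎
      where open ≡-Reasoning

  count-by-completions : ∀ r m → sum (map (completions m r ∘ run) (I m)) ≡ sum (map (live ∘ run) (I (m + r)))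
  count-by-completions zero    m = cong (λ k → sum (map (live ∘ run) (I k))) (sym (+-identityʳ m))
  count-by-completions (suc r) m = begin
    sum (map (completions m (suc r) ∘ run) (I m))        ≡⟨ sum-I-suc m (completions (suc m) r) ⟨
    sum (map (completions (suc m) r ∘ run) (I (suc m)))  ≡⟨ count-by-completions r (suc m) ⟩
    sum (map (live ∘ run) (I (suc m + r)))               ≡⟨ cong (λ k → sum (map (live ∘ run) (I k))) (+-suc m r) ⟨
    sum (map (live ∘ run) (I (m + suc r)))               ∎
    where open ≡-Reasoning

  a≡completions : ∀ n → a n ≡ completions 0 n (ascending 0)
  a≡completions n = trans (a≡live-count n) (trans (sym (count-by-completions n 0)) (+-identityʳ _))

  completions-dead : ∀ m r → completions m r dead ≡ 0
  completions-dead m zero    = refl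
  completions-dead m (suc r) = Σ<-vanishing _ {k = suc m} z≤n (λ x _ → completions-dead (suc m) r)

  -- After a descent with last entry d the remaining r entries must be strictly decreasing
  -- below d: there are C(d, r) ways.
  completions-descending : ∀ {m d} r → d ≤ m → completions m r (descending d) ≡ d C r
  completions-descending     zero    d≤m = refl
  completions-descending {m} {d} (suc r) d≤m = begin
    Σ< f (suc m)       ≡⟨ Σ<-vanishing f (m≤n⇒m≤1+n d≤m) dies ⟩
    Σ< f d             ≡⟨ Σ<-cong f (_C r) d continues ⟩
    Σ< (_C r) d        ≡⟨ hockey-stick r d ⟩
    d C suc r          ∎
    where
    open ≡-Reasoning
    f : ℕ → ℕ
    f x = completions (suc m) r (step (descending d) x)
    dies : ∀ x → d ≤ x → f x ≡ 0
    dies x d≤x = trans (cong (completions (suc m) r) (step-descending-≥ d≤x)) (completions-dead (suc m) r)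
    continues : ∀ x → x < d → f x ≡ x C r
    continues x x<d = trans (cong (completions (suc m) r) (step-descending-< x<d))
                            (completions-descending r (≤-trans (<⇒≤ x<d) (m≤n⇒m≤1+n d≤m)))

  -- Recurrence (A): from a sequence of length M ending in its maximum M, the next entry either
  -- goes below M (starting the decreasing part) or repeats M.
  completions-ascending-full : ∀ M r →
    completions M (suc r) (ascending M) ≡ M C suc r + completions (suc M) r (ascending M)
  completions-ascending-full M r = begin
    Σ< f M + f M                                 ≡⟨ cong (_+ f M) (Σ<-cong f (_C r) M down) ⟩
    Σ< (_C r) M + f M                            ≡⟨ cong₂ _+_ (hockey-stick r M) (cong (completions (suc M) r) (step-ascending-≥ ≤-refl)) ⟩
    M C suc r + completions (suc M) r (ascending M) ∎
    where
    open ≡-Reasoning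
    f : ℕ → ℕ
    f x = completions (suc M) r (step (ascending M) x)
    down : ∀ x → x < M → f x ≡ x C r
    down x x<M = trans (cong (completions (suc M) r) (step-ascending-< x<M))
                       (completions-descending r (≤-trans (<⇒≤ x<M) (n≤1+n M)))

  -- Recurrence (B): raising the current maximum from M to M+1 only changes the outcome of
  -- appending x = M, which becomes the start of a decreasing part.
  completions-ascending-shift : ∀ {m M} r → M ≤ m →
    completions m (suc r) (ascending M) + M C r ≡ completions m (suc r) (ascending (suc M)) + completions (suc m) r (ascending M)
  completions-ascending-shift {m} {M} r M≤m = begin
    Σ< f (suc m) + M C r  ≡⟨ cong (Σ< f (suc m) +_) gM ⟨
    Σ< f (suc m) + g M    ≡⟨ Σ<-exchange f g (suc m) (s≤s M≤m) agree ⟩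
    Σ< g (suc m) + f M    ≡⟨ cong (Σ< g (suc m) +_) (cong (completions (suc m) r) (step-ascending-≥ ≤-refl)) ⟩
    completions m (suc r) (ascending (suc M)) + completions (suc m) r (ascending M) ∎
    where
    open ≡-Reasoning
    f g : ℕ → ℕ
    f x = completions (suc m) r (step (ascending M) x)
    g x = completions (suc m) r (step (ascending (suc M)) x)
    gM : g M ≡ M C r
    gM = trans (cong (completions (suc m) r) (step-ascending-< ≤-refl)) (completions-descending r (m≤n⇒m≤1+n M≤m))
    agree : ∀ x → x ≢ M → f x ≡ g x
    agree x x≢M with <-cmp x M
    ... | tri< x<M _ _ = cong (completions (suc m) r) (trans (step-ascending-< x<M) (sym (step-ascending-< (m<n⇒m<1+n x<M))))
    ... | tri≈ _ x≡M _ = ⊥-elim (x≢M x≡M)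
    ... | tri> _ _ M<x = cong (completions (suc m) r) (trans (step-ascending-≥ (<⇒≤ M<x)) (sym (step-ascending-≥ M<x)))


module RecurrenceSystem where

  open import Data.Nat using (ℕ; zero; suc)
  import Data.Nat as ℕ
  import Data.Nat.Properties as ℕP
  open import Data.Nat.Combinatorics using (_C_)
  open import Data.Integer using (ℤ; +_; _+_; _*_; _^_)
  import Data.Integer.Properties as ℤP
  open import Data.Integer.Tactic.RingSolver using (solve-∀)
  open import Algebra.Properties.AbelianGroup ℤP.+-0-abelianGroup using (∙-cancelʳ)
  open import Relation.Binary.PropositionalEquality
  open import Defs using (FPS)
  open PowerSeries using (z·_; binomial)
  open Scan using (ascending)
  open Counting

  -- The recurrences (A) and (B), scaled so that their solution has integer coefficients, as a
  -- system of equations for a doubly indexed family X s M of power series.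
  record Solution (X : ℕ → ℕ → FPS) : Set where
    field
      eqA : ∀ M n → + 2 * X 0 M n ≡ + 8 * binomial M n + (z· X 1 M) n
      eqB : ∀ s M n → + 2 * X (suc s) M n + (+ 2) ^ (4 ℕ.+ s) * (z· binomial M) n
                    ≡ + 4 * X s (suc M) n + (z· X (2 ℕ.+ s) M) n

  -- The system has at most one solution: the coefficient of zⁿ in X s M is determined by the
  -- coefficients of zⁿ in X s′ M′ with s′ < s and those of z^(n−1).
  solution-unique : ∀ {X Y} → Solution X → Solution Y → ∀ n s M → X s M n ≡ Y s M n
  solution-unique {X} {Y} solX solY = agree
    where
    module X = Solution solX
    module Y = Solution solY
    agree : ∀ n s M → X s M n ≡ Y s M n
    agree-z· : ∀ n s M → (z· X s M) n ≡ (z· Y s M) n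
    agree-z· zero    s M = refl
    agree-z· (suc n) s M = agree n s M
    agree n zero M = ℤP.*-cancelˡ-≡ (+ 2) _ _ (begin
      + 2 * X 0 M n                         ≡⟨ X.eqA M n ⟩
      + 8 * binomial M n + (z· X 1 M) n     ≡⟨ cong (λ t → + 8 * binomial M n + t) (agree-z· n 1 M) ⟩
      + 8 * binomial M n + (z· Y 1 M) n     ≡⟨ Y.eqA M n ⟨
      + 2 * Y 0 M n                         ∎)
      where open ≡-Reasoning
    agree n (suc s) M = ℤP.*-cancelˡ-≡ (+ 2) _ _ (∙-cancelʳ _ _ _ (begin
      + 2 * X (suc s) M n + c                               ≡⟨ X.eqB s M n ⟩
      + 4 * X s (suc M) n + (z· X (2 ℕ.+ s) M) n            ≡⟨ cong₂ (λ t u → + 4 * t + u) (agree n s (suc M)) (agree-z· n (2 ℕ.+ s) M) ⟩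
      + 4 * Y s (suc M) n + (z· Y (2 ℕ.+ s) M) n            ≡⟨ Y.eqB s M n ⟨
      + 2 * Y (suc s) M n + c                               ∎))
      where
      open ≡-Reasoning
      c : ℤ
      c = (+ 2) ^ (4 ℕ.+ s) * (z· binomial M) n

  -- K s M r counts the completions by r entries of a sequence of length s + M that ends in its
  -- maximum M.
  K : ℕ → ℕ → ℕ → ℕ
  K s M r = completions (s ℕ.+ M) r (ascending M)

  K-A : ∀ M r → K 0 M (suc r) ≡ M C suc r ℕ.+ K 1 M r
  K-A = completions-ascending-full

  K-B : ∀ s M r → K (suc s) M (suc r) ℕ.+ M C r ≡ K s (suc M) (suc r) ℕ.+ K (2 ℕ.+ s) M r
  K-B s M r = trans (completions-ascending-shift r (ℕP.m≤n+m M (suc s)))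
    (cong (λ m → completions m (suc r) (ascending (suc M)) ℕ.+ K (2 ℕ.+ s) M r) (sym (ℕP.+-suc s M)))

  scaledK : ℕ → ℕ → FPS
  scaledK s M r = (+ 2) ^ (2 ℕ.+ s) * + K s M r

  private
    pos-+-≡ : ∀ {k b c d} → k ℕ.+ b ≡ c ℕ.+ d → + k + + b ≡ + c + + d
    pos-+-≡ {k} {b} {c} {d} e = trans (sym (ℤP.pos-+ k b)) (trans (cong +_ e) (ℤP.pos-+ c d))

    scaled-A : ∀ {k b c} → k ≡ b ℕ.+ c → + 2 * (+ 4 * + k) ≡ + 8 * + b + + 8 * + c
    scaled-A {k} {b} {c} e = trans (cong (λ t → + 2 * (+ 4 * t)) (trans (cong +_ e) (ℤP.pos-+ b c))) (distrib (+ b) (+ c))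
      where
      distrib : ∀ x y → + 2 * (+ 4 * (x + y)) ≡ + 8 * x + + 8 * y
      distrib = solve-∀

    scaled-B : ∀ u {k b c d} → k ℕ.+ b ≡ c ℕ.+ d →
               + 2 * (+ 2 * u * + k) + + 2 * (+ 2 * u) * + b ≡ + 4 * (u * + c) + + 2 * (+ 2 * u) * + d
    scaled-B u {k} {b} {c} {d} e =
      trans (left u (+ k) (+ b)) (trans (cong (λ t → + 4 * u * t) (pos-+-≡ {k} {b} {c} {d} e)) (sym (right u (+ c) (+ d))))
      where
      left : ∀ u x y → + 2 * (+ 2 * u * x) + + 2 * (+ 2 * u) * y ≡ + 4 * u * (x + y)
      left = solve-∀
      right : ∀ u x y → + 4 * (u * x) + + 2 * (+ 2 * u) * y ≡ + 4 * u * (x + y)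
      right = solve-∀

  scaledK-solution : Solution scaledK
  scaledK-solution = record { eqA = eqA ; eqB = eqB }
    where
    eqA : ∀ M n → + 2 * scaledK 0 M n ≡ + 8 * binomial M n + (z· scaledK 1 M) n
    eqA M zero    = refl
    eqA M (suc r) = scaled-A {b = M C suc r} {c = K 1 M r} (K-A M r)
    eqB : ∀ s M n → + 2 * scaledK (suc s) M n + (+ 2) ^ (4 ℕ.+ s) * (z· binomial M) n
                  ≡ + 4 * scaledK s (suc M) n + (z· scaledK (2 ℕ.+ s) M) n
    eqB s M zero    = initial ((+ 2) ^ (2 ℕ.+ s))
      where
      initial : ∀ u → + 2 * (+ 2 * u * + 1) + + 2 * (+ 2 * u) * + 0 ≡ + 4 * (u * + 1) + + 0
      initial = solve-∀
    eqB s M (suc r) = scaled-B ((+ 2) ^ (2 ℕ.+ s)) {b = M C r} {c = K s (suc M) (suc r)} {d = K (2 ℕ.+ s) M r} (K-B s M r)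


open import Data.Nat using (ℕ; zero; suc)
import Data.Nat as ℕ
open import Data.Integer using (+_; _+_; _*_; -_; _^_)
import Data.Integer.Properties as ℤP
open import Relation.Binary.PropositionalEquality
open import Algebra.Bundles using (CommutativeRing)
open import Defs
open PowerSeries
open Solver using (solve; _:=_; _:+_; _:*_; :-_; con)
open RecurrenceSystem using (Solution; scaledK; scaledK-solution; solution-unique)
open Counting using (a≡completions)
open CommutativeRing ring using (+-cong; *-cong)
  renaming (setoid to seriesSetoid; refl to ≈-refl; sym to ≈-sym)
import Relation.Binary.Reasoning.Setoid seriesSetoid as ≈-Reasoning

module AlgebraicSolution
  (σ : FPS)
  (quadratic : const (+ 2) ⋆ σ ≈ const (+ 4) ⋆ 1+z ⊕ Z ⋆ (σ ⋆ σ))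
  where

  Q : ℕ → ℕ → FPS
  Q s M = 1+z ^ˢ M ⋆ (const (+ 2) ^ˢ suc s ⊕ σ ^ˢ suc s)

  substitute : ∀ f g → f ⋆ (const (+ 2) ⋆ σ) ⊕ g ≈ f ⋆ (const (+ 4) ⋆ 1+z ⊕ Z ⋆ (σ ⋆ σ)) ⊕ g
  substitute f g = +-cong (*-cong {f} ≈-refl quadratic) (≈-refl {g})

  Q-A : ∀ M → const (+ 2) ⋆ Q 0 M ≈ const (+ 8) ⋆ 1+z ^ˢ M ⊕ Z ⋆ Q 1 M
  Q-A M = begin
    const (+ 2) ⋆ Q 0 M
      ≈⟨ solve 2 (λ v s → con (+ 2) :* (v :* (con (+ 2) :* con (+ 1) :+ s :* con (+ 1)))
                       := v :* (con (+ 2) :* s) :+ con (+ 4) :* v) ≈-refl v σ ⟩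
    v ⋆ (const (+ 2) ⋆ σ) ⊕ const (+ 4) ⋆ v
      ≈⟨ substitute v (const (+ 4) ⋆ v) ⟩
    v ⋆ (const (+ 4) ⋆ 1+z ⊕ Z ⋆ (σ ⋆ σ)) ⊕ const (+ 4) ⋆ v
      ≈⟨ solve 3 (λ v s z → v :* (con (+ 4) :* (con (+ 1) :+ z) :+ z :* (s :* s)) :+ con (+ 4) :* v
                         := con (+ 8) :* v :+ z :* (v :* (con (+ 2) :* (con (+ 2) :* con (+ 1)) :+ s :* (s :* con (+ 1)))))
               ≈-refl v σ Z ⟩
    const (+ 8) ⋆ v ⊕ Z ⋆ Q 1 M
      ∎
    where
    open ≈-Reasoning
    v : FPS
    v = 1+z ^ˢ M

  Q-B : ∀ s M → const (+ 2) ⋆ Q (suc s) M ⊕ const (+ 2) ^ˢ (4 ℕ.+ s) ⋆ (Z ⋆ 1+z ^ˢ M)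
              ≈ const (+ 4) ⋆ Q s (suc M) ⊕ Z ⋆ Q (2 ℕ.+ s) M
  Q-B s M = begin
    const (+ 2) ⋆ Q (suc s) M ⊕ const (+ 2) ^ˢ (4 ℕ.+ s) ⋆ (Z ⋆ v)
      ≈⟨ solve 5 (λ v s p t z → con (+ 2) :* (v :* (con (+ 2) :* t :+ s :* p))
                                :+ con (+ 2) :* (con (+ 2) :* (con (+ 2) :* t)) :* (z :* v)
                             := v :* p :* (con (+ 2) :* s)
                                :+ (con (+ 4) :* v :* t :+ con (+ 8) :* t :* z :* v))
                 ≈-refl v σ p t Z ⟩
    v ⋆ p ⋆ (const (+ 2) ⋆ σ) ⊕ rest
      ≈⟨ substitute (v ⋆ p) rest ⟩
    v ⋆ p ⋆ (const (+ 4) ⋆ 1+z ⊕ Z ⋆ (σ ⋆ σ)) ⊕ rest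
      ≈⟨ solve 5 (λ v s p t z → v :* p :* (con (+ 4) :* (con (+ 1) :+ z) :+ z :* (s :* s))
                                :+ (con (+ 4) :* v :* t :+ con (+ 8) :* t :* z :* v)
                             := con (+ 4) :* ((con (+ 1) :+ z) :* v :* (t :+ p))
                                :+ z :* (v :* (con (+ 2) :* (con (+ 2) :* t) :+ s :* (s :* p))))
                 ≈-refl v σ p t Z ⟩
    const (+ 4) ⋆ Q s (suc M) ⊕ Z ⋆ Q (2 ℕ.+ s) M
      ∎
    where
    open ≈-Reasoning
    v p t rest : FPS
    v = 1+z ^ˢ M
    p = σ ^ˢ suc s
    t = const (+ 2) ^ˢ suc s
    rest = const (+ 4) ⋆ v ⋆ t ⊕ const (+ 8) ⋆ t ⋆ Z ⋆ v

  Q-solution : Solution Q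
  Q-solution = record { eqA = eqA ; eqB = eqB }
    where
    open ≡-Reasoning
    eqA : ∀ M n → + 2 * Q 0 M n ≡ + 8 * binomial M n + (z· Q 1 M) n
    eqA M n = begin
      + 2 * Q 0 M n                                        ≡⟨ const-⋆ (+ 2) (Q 0 M) n ⟨
      (const (+ 2) ⋆ Q 0 M) n                              ≡⟨ Q-A M n ⟩
      (const (+ 8) ⋆ 1+z ^ˢ M) n + (Z ⋆ Q 1 M) n             ≡⟨ cong₂ _+_ (const-⋆-coeff (+ 8) (binomial-theorem M) n) (Z⋆≈z· (Q 1 M) n) ⟩
      + 8 * binomial M n + (z· Q 1 M) n                    ∎
    eqB : ∀ s M n → + 2 * Q (suc s) M n + (+ 2) ^ (4 ℕ.+ s) * (z· binomial M) n
                  ≡ + 4 * Q s (suc M) n + (z· Q (2 ℕ.+ s) M) n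
    eqB s M n = begin
      + 2 * Q (suc s) M n + (+ 2) ^ (4 ℕ.+ s) * (z· binomial M) n
        ≡⟨ cong₂ _+_ (const-⋆ (+ 2) (Q (suc s) M) n) power-term ⟨
      (const (+ 2) ⋆ Q (suc s) M) n + (const (+ 2) ^ˢ (4 ℕ.+ s) ⋆ (Z ⋆ 1+z ^ˢ M)) n
        ≡⟨ Q-B s M n ⟩
      (const (+ 4) ⋆ Q s (suc M)) n + (Z ⋆ Q (2 ℕ.+ s) M) n
        ≡⟨ cong₂ _+_ (const-⋆ (+ 4) (Q s (suc M)) n) (Z⋆≈z· (Q (2 ℕ.+ s) M) n) ⟩
      + 4 * Q s (suc M) n + (z· Q (2 ℕ.+ s) M) n
        ∎
      where
      power-term : (const (+ 2) ^ˢ (4 ℕ.+ s) ⋆ (Z ⋆ 1+z ^ˢ M)) n ≡ (+ 2) ^ (4 ℕ.+ s) * (z· binomial M) n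
      power-term = trans (⋆-congˡ (Z ⋆ 1+z ^ˢ M) (const-^ (+ 2) (4 ℕ.+ s)) n)
                         (const-⋆-coeff ((+ 2) ^ (4 ℕ.+ s)) (λ k → trans (Z⋆≈z· (1+z ^ˢ M) k) (z·-cong (binomial-theorem M) k)) n)


-- Let S be a square root of 1 − 4z − 4z² with S₀ = 1, and write S = 1 − zσ.  Expanding S² shows
-- that σ satisfies  2σ = 4(1 + z) + zσ².
module SquareRoot (S : FPS) (S₀ : S 0 ≡ + 1)
  (square : S ⋆ S ≈ const (+ 1) ⊕ neg (const (+ 4) ⋆ Z) ⊕ neg (const (+ 4) ⋆ (Z ⋆ Z))) where

  σ : FPS
  σ = neg (tail S)

  S≈1-zσ : S ≈ const (+ 1) ⊕ neg (Z ⋆ σ)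
  S≈1-zσ zero    = trans S₀ (sym (cong (λ x → + 1 + - x) (Z⋆≈z· σ 0)))
  S≈1-zσ (suc n) = sym (trans (cong (λ x → + 0 + - x) (Z⋆≈z· σ (suc n)))
                              (trans (ℤP.+-identityˡ _) (ℤP.neg-involutive (S (suc n)))))

  -- The defect of the quadratic equation; z times it vanishes.
  defect : FPS
  defect = const (+ 2) ⋆ σ ⊕ neg (const (+ 4) ⋆ 1+z ⊕ Z ⋆ (σ ⋆ σ))

  Z⋆defect≈0 : Z ⋆ defect ≈ const (+ 0)
  Z⋆defect≈0 = begin
    Z ⋆ defect
      ≈⟨ solve 2 (λ s z → z :* (con (+ 2) :* s :+ :- (con (+ 4) :* (con (+ 1) :+ z) :+ z :* (s :* s)))
                       := (con (+ 1) :+ :- (con (+ 4) :* z) :+ :- (con (+ 4) :* (z :* z)))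
                          :+ :- ((con (+ 1) :+ :- (z :* s)) :* (con (+ 1) :+ :- (z :* s))))
               ≈-refl σ Z ⟩
    T ⊕ neg ((const (+ 1) ⊕ neg (Z ⋆ σ)) ⋆ (const (+ 1) ⊕ neg (Z ⋆ σ)))
      ≈⟨ +-cong (≈-refl {T}) (λ n → cong -_ (*-cong (≈-sym S≈1-zσ) (≈-sym S≈1-zσ) n)) ⟩
    T ⊕ neg (S ⋆ S)
      ≈⟨ +-cong (≈-refl {T}) (λ n → cong -_ (square n)) ⟩
    T ⊕ neg T
      ≈⟨ solve 1 (λ t → t :+ :- t := con (+ 0)) ≈-refl T ⟩
    const (+ 0)
      ∎
    where
    open ≈-Reasoning
    T : FPS
    T = const (+ 1) ⊕ neg (const (+ 4) ⋆ Z) ⊕ neg (const (+ 4) ⋆ (Z ⋆ Z))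

  quadratic : const (+ 2) ⋆ σ ≈ const (+ 4) ⋆ 1+z ⊕ Z ⋆ (σ ⋆ σ)
  quadratic = begin
    const (+ 2) ⋆ σ
      ≈⟨ solve 2 (λ s z → con (+ 2) :* s
                       := (con (+ 2) :* s :+ :- (con (+ 4) :* (con (+ 1) :+ z) :+ z :* (s :* s)))
                          :+ (con (+ 4) :* (con (+ 1) :+ z) :+ z :* (s :* s))) ≈-refl σ Z ⟩
    defect ⊕ (const (+ 4) ⋆ 1+z ⊕ Z ⋆ (σ ⋆ σ))
      ≈⟨ +-cong defect≈0 ≈-refl ⟩
    zeroˢ ⊕ (const (+ 4) ⋆ 1+z ⊕ Z ⋆ (σ ⋆ σ))
      ≈⟨ (λ n → ℤP.+-identityˡ _) ⟩
    const (+ 4) ⋆ 1+z ⊕ Z ⋆ (σ ⋆ σ)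
      ∎
    where
    open ≈-Reasoning
    defect≈0 : defect ≈ zeroˢ
    defect≈0 n = trans (sym (Z⋆≈z· defect (suc n))) (Z⋆defect≈0 (suc n))



square-in-ring : ∀ S → (∀ n → (S ⊛ S) n ≡ (const (+ 1) ⊖ ((+ 4) · Z) ⊖ ((+ 4) · (Z ⊛ Z))) n) →
                 S ⋆ S ≈ const (+ 1) ⊕ neg (const (+ 4) ⋆ Z) ⊕ neg (const (+ 4) ⋆ (Z ⋆ Z))
square-in-ring S square n =
  trans (sym (⊛≈⋆ S S n))
        (trans (square n) (cong₂ (λ x y → const (+ 1) n + - x + - y)
                                 (sym (const-⋆ (+ 4) Z n))
                                 (trans (cong (+ 4 *_) (⊛≈⋆ Z Z n)) (sym (const-⋆ (+ 4) (Z ⋆ Z) n)))))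

-- 4aₙ is the coefficient of zⁿ in both solutions of the system at s = M = 0, i.e. in 2 + σ.
theorem2p4 : (S : FPS) → S 0 ≡ + 1 →
    (∀ n → (S ⊛ S) n ≡ (const (+ 1) ⊖ ((+ 4) · Z) ⊖ ((+ 4) · (Z ⊛ Z))) n) →
    ∀ n → ((+ 4) · (Z ⊛ A)) n ≡ (const (+ 1) ⊕ ((+ 2) · Z) ⊖ S) n
theorem2p4 S S₀ square zero    rewrite S₀ = refl
theorem2p4 S S₀ square (suc m) = begin
  + 4 * (Z ⊛ A) (suc m)   ≡⟨ cong (+ 4 *_) (trans (⊛≈⋆ Z A (suc m)) (Z⋆≈z· A (suc m))) ⟩
  + 4 * + a m             ≡⟨ cong (λ k → + 4 * + k) (a≡completions m) ⟩
  scaledK 0 0 m           ≡⟨ solution-unique scaledK-solution Q-solution m 0 0 ⟩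
  Q 0 0 m                 ≡⟨ Q₀₀ m ⟩
  (const (+ 2) ⊕ σ) m     ≡⟨ shifted m ⟩
  (const (+ 1) ⊕ ((+ 2) · Z) ⊖ S) (suc m) ∎
  where
  open ≡-Reasoning
  open SquareRoot S S₀ (square-in-ring S square) using (σ; quadratic)
  open AlgebraicSolution σ quadratic using (Q; Q-solution)
  Q₀₀ : Q 0 0 ≈ const (+ 2) ⊕ σ
  Q₀₀ = solve 1 (λ s → con (+ 1) :* (con (+ 2) :* con (+ 1) :+ s :* con (+ 1)) := con (+ 2) :+ s) ≈-refl σ
  shifted : ∀ m → (const (+ 2) ⊕ σ) m ≡ (const (+ 1) ⊕ ((+ 2) · Z) ⊖ S) (suc m)
  shifted zero    = refl
  shifted (suc m) = refl
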